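{- Let $n\ge 1$, $w\in\mathbb{R}^n$, $a\in\{0,1\}^n$, let $b\ge 0$ be an integer, and consider the problem $$\max\ \sum_{i=1}^n w_ix_i\quad\text{s.t.}\quad \sum_{i=1}^n a_ix_i\le b,\quad x\in\{0,1\}^n. \qquad (\mathrm{P})$$ Let $M\ge 0$ be an integer, and for $(x,y)\in[0,1]^n\times[0,1]^{M+1}$ let $$s(y):=\sum_{\ell=0}^M 2^\ell y_\ell,\qquad r(x,y):=a^\top x+s(y)-b,$$ $$V_{\mathrm{be}}(x,y):=r(x,y)^2-\sum_{i=1}^n a_ix_i^2+\sum_{i=1}^n a_ix_i,\qquad \hat f(x,y):=-w^\top x+\gamma V_{\mathrm{be}}(x,y),$$ with penalty weight $\gamma>0$. Assume that every local minimizer $(x^\star,y^\star)$ of $\hat f$ over $[0,1]^n\times[0,1]^{M+1}$ has binary core, i.e. $x^\star\in\{0,1\}^n$. If $\gamma>\max_i w_i$, then for every local minimizer $(x^\star,y^\star)$ of $\hat f$ over $[0,1]^n\times[0,1]^{M+1}$, the point $x^\star$ is feasible for $(\mathrm{P})$.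
   Context: A local minimizer over the box is a point of the box minimizing $\hat f$ among all points of the box in some neighborhood of it. The variables $x$ are the core (decision) variables and $y$ are slack bits. -}

module Defs where

open import Data.Fin.Base using (toℕ)
open import Data.Integer.Base using (+_)
open import Data.Nat.Base as ℕ using (ℕ; suc)
import Data.Nat.Properties as ℕ
open import Data.Product.Base using (∃-syntax; _×_; _,_)
open import Data.Rational.Base as ℚ using (ℚ; 0ℚ; 1ℚ; ½)
import Data.Rational.Properties as ℚ
open import Data.Rational.Solver using (module +-*-Solver)
open import Data.Sum.Base using (_⊎_; inj₁; inj₂)
open import Data.Vec.Functional using (Vector; foldr; head; tail; map; zipWith)
open import Relation.Binary.PropositionalEquality
  using (_≡_; refl; sym; trans; cong; subst)

------------------------------------------------------------------------
-- Real numbers: Cauchy sequences of rationals, taken up to the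
-- equivalence _≈_ (a setoid instead of a quotient).

Eventually : (ℕ → Set) → Set
Eventually P = ∃[ N ] (∀ n → N ℕ.≤ n → P n)

IsCauchy : (ℕ → ℚ) → Set
IsCauchy s = ∀ ε → 0ℚ ℚ.< ε →
  ∃[ N ] (∀ m n → N ℕ.≤ m → N ℕ.≤ n → ℚ.∣ s m ℚ.- s n ∣ ℚ.< ε)

record ℝ : Set where
  constructor mkℝ
  field
    seq    : ℕ → ℚ
    cauchy : IsCauchy seq

open ℝ public

infix 4 _≈_ _≤_ _<_

_≈_ : ℝ → ℝ → Set
x ≈ y = ∀ ε → 0ℚ ℚ.< ε → Eventually λ n → ℚ.∣ seq x n ℚ.- seq y n ∣ ℚ.< ε

_≤_ : ℝ → ℝ → Set
x ≤ y = ∀ ε → 0ℚ ℚ.< ε → Eventually λ n → seq x n ℚ.< seq y n ℚ.+ ε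

-- The gap ε must be uniform: a termwise strict inequality can collapse
-- in the limit.
_<_ : ℝ → ℝ → Set
x < y = ∃[ ε ] (0ℚ ℚ.< ε × Eventually λ n → seq x n ℚ.+ ε ℚ.< seq y n)

private
  open +-*-Solver

  half-pos : ∀ {ε} → 0ℚ ℚ.< ε → 0ℚ ℚ.< ε ℚ.* ½
  half-pos {ε} 0<ε =
    subst (ℚ._< ε ℚ.* ½) (ℚ.*-zeroˡ ½) (ℚ.*-monoˡ-<-pos ½ 0<ε)

  half+half : ∀ ε → ε ℚ.* ½ ℚ.+ ε ℚ.* ½ ≡ ε
  half+half ε = trans (sym (ℚ.*-distribˡ-+ ε ½ ½)) (ℚ.*-identityʳ ε)

  ∣-∣<⇒< : ∀ p q {ε} → ℚ.∣ p ℚ.- q ∣ ℚ.< ε → p ℚ.< q ℚ.+ ε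
  ∣-∣<⇒< p q {ε} h = subst (ℚ._< q ℚ.+ ε)
    (solve 2 (λ p q → q :+ (p :- q) := p) refl p q)
    (ℚ.+-monoʳ-< q (ℚ.≤-<-trans (p≤∣p∣ (p ℚ.- q)) h))
    where
    p≤∣p∣ : ∀ p → p ℚ.≤ ℚ.∣ p ∣
    p≤∣p∣ p with ℚ.≤-total 0ℚ p
    ... | inj₁ 0≤p = ℚ.≤-reflexive (sym (ℚ.0≤p⇒∣p∣≡p 0≤p))
    ... | inj₂ p≤0 = ℚ.≤-trans p≤0 (ℚ.0≤∣p∣ p)

  <⇒-< : ∀ p q {ε} → p ℚ.< q ℚ.+ ε → p ℚ.- q ℚ.< ε
  <⇒-< p q {ε} h = subst (p ℚ.- q ℚ.<_)
    (solve 2 (λ q ε → (q :+ ε) :- q := ε) refl q ε)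
    (ℚ.+-monoˡ-< (ℚ.- q) h)

  <⇒∣-∣< : ∀ p q {ε} → p ℚ.< q ℚ.+ ε → q ℚ.< p ℚ.+ ε → ℚ.∣ p ℚ.- q ∣ ℚ.< ε
  <⇒∣-∣< p q {ε} h k with ℚ.∣p∣≡p∨∣p∣≡-p (p ℚ.- q)
  ... | inj₁ e = subst (ℚ._< ε) (sym e) (<⇒-< p q h)
  ... | inj₂ e = subst (ℚ._< ε)
    (sym (trans e (solve 2 (λ p q → :- (p :- q) := q :- p) refl p q)))
    (<⇒-< q p k)

  const-cauchy : ∀ q → IsCauchy (λ _ → q)
  const-cauchy q ε 0<ε = 0 , λ _ _ _ _ →
    subst (ℚ._< ε) (sym (cong ℚ.∣_∣ (ℚ.+-inverseʳ q))) 0<ε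

  +-cauchy : ∀ x y → IsCauchy (λ n → seq x n ℚ.+ seq y n)
  +-cauchy (mkℝ s cs) (mkℝ t ct) ε 0<ε
    with cs (ε ℚ.* ½) (half-pos 0<ε) | ct (ε ℚ.* ½) (half-pos 0<ε)
  ... | N , hs | K , ht = N ℕ.⊔ K , λ m n m≥ n≥ → begin-strict
    ℚ.∣ (s m ℚ.+ t m) ℚ.- (s n ℚ.+ t n) ∣
      ≡⟨ cong ℚ.∣_∣ (solve 4 (λ a b c d →
           (a :+ b) :- (c :+ d) := (a :- c) :+ (b :- d)) refl
           (s m) (t m) (s n) (t n)) ⟩
    ℚ.∣ (s m ℚ.- s n) ℚ.+ (t m ℚ.- t n) ∣
      ≤⟨ ℚ.∣p+q∣≤∣p∣+∣q∣ (s m ℚ.- s n) (t m ℚ.- t n) ⟩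
    ℚ.∣ s m ℚ.- s n ∣ ℚ.+ ℚ.∣ t m ℚ.- t n ∣
      <⟨ ℚ.+-mono-< (hs m n (ℕ.m⊔n≤o⇒m≤o N K m≥) (ℕ.m⊔n≤o⇒m≤o N K n≥))
                    (ht m n (ℕ.m⊔n≤o⇒n≤o N K m≥) (ℕ.m⊔n≤o⇒n≤o N K n≥)) ⟩
    ε ℚ.* ½ ℚ.+ ε ℚ.* ½
      ≡⟨ half+half ε ⟩
    ε ∎
    where open ℚ.≤-Reasoning

  neg-cauchy : ∀ x → IsCauchy (λ n → ℚ.- seq x n)
  neg-cauchy (mkℝ s cs) ε 0<ε with cs ε 0<ε
  ... | N , hs = N , λ m n m≥ n≥ → subst (ℚ._< ε)
    (cong ℚ.∣_∣ (solve 2 (λ a b → a :- b := (:- b) :- (:- a)) refl (s n) (s m)))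
    (hs n m n≥ m≥)

  cauchy-bounded : ∀ x →
    ∃[ B ] (0ℚ ℚ.< B × Eventually λ n → ℚ.∣ seq x n ∣ ℚ.< B)
  cauchy-bounded (mkℝ s cs) with cs 1ℚ (ℚ.positive⁻¹ 1ℚ)
  ... | N , hs = ℚ.∣ s N ∣ ℚ.+ 1ℚ
    , ℚ.+-mono-≤-< (ℚ.0≤∣p∣ (s N)) (ℚ.positive⁻¹ 1ℚ)
    , N , λ n n≥ → begin-strict
      ℚ.∣ s n ∣
        ≡⟨ cong ℚ.∣_∣ (solve 2 (λ a b → a := b :+ (a :- b)) refl (s n) (s N)) ⟩
      ℚ.∣ s N ℚ.+ (s n ℚ.- s N) ∣
        ≤⟨ ℚ.∣p+q∣≤∣p∣+∣q∣ (s N) (s n ℚ.- s N) ⟩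
      ℚ.∣ s N ∣ ℚ.+ ℚ.∣ s n ℚ.- s N ∣
        <⟨ ℚ.+-monoʳ-< ℚ.∣ s N ∣ (hs n N n≥ ℕ.≤-refl) ⟩
      ℚ.∣ s N ∣ ℚ.+ 1ℚ ∎
    where open ℚ.≤-Reasoning

  divide : ∀ {C ε} → 0ℚ ℚ.< C → 0ℚ ℚ.< ε → ∃[ δ ] (0ℚ ℚ.< δ × C ℚ.* δ ≡ ε)
  divide {C} {ε} 0<C 0<ε = (ℚ.1/ C) ℚ.* ε
    , ℚ.positive⁻¹ _ {{ℚ.pos*pos⇒pos (ℚ.1/ C) {{ℚ.1/pos⇒pos C}} ε}}
    , trans (sym (ℚ.*-assoc C (ℚ.1/ C) ε))
        (trans (cong (ℚ._* ε) (ℚ.*-inverseʳ C)) (ℚ.*-identityˡ ε))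
    where
    instance
      C-pos = ℚ.positive 0<C
      ε-pos = ℚ.positive 0<ε
      C-nz  = ℚ.pos⇒nonZero C

  *-bound : ∀ p q {B δ} → ℚ.∣ p ∣ ℚ.< B → 0ℚ ℚ.< δ → ℚ.∣ q ∣ ℚ.< δ →
    ℚ.∣ p ℚ.* q ∣ ℚ.< B ℚ.* δ
  *-bound p q {B} {δ} p<B 0<δ q<δ = begin-strict
    ℚ.∣ p ℚ.* q ∣
      ≡⟨ ℚ.∣p*q∣≡∣p∣*∣q∣ p q ⟩
    ℚ.∣ p ∣ ℚ.* ℚ.∣ q ∣
      ≤⟨ ℚ.*-monoˡ-≤-nonNeg ℚ.∣ p ∣ {{ℚ.∣-∣-nonNeg p}} (ℚ.<⇒≤ q<δ) ⟩
    ℚ.∣ p ∣ ℚ.* δ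
      <⟨ ℚ.*-monoˡ-<-pos δ {{ℚ.positive 0<δ}} p<B ⟩
    B ℚ.* δ ∎
    where open ℚ.≤-Reasoning

  *-cauchy : ∀ x y → IsCauchy (λ n → seq x n ℚ.* seq y n)
  *-cauchy x@(mkℝ s cs) y@(mkℝ t ct) ε 0<ε =
    let A , 0<A , Na , hA = cauchy-bounded x
        B , 0<B , Nb , hB = cauchy-bounded y
        δ , 0<δ , eq = divide (ℚ.+-mono-< 0<A 0<B) 0<ε
        N , hs = cs δ 0<δ
        K , ht = ct δ 0<δ
    in (Na ℕ.⊔ Nb) ℕ.⊔ (N ℕ.⊔ K) , λ m n m≥ n≥ →
    let m≥₁ = ℕ.m⊔n≤o⇒m≤o (Na ℕ.⊔ Nb) (N ℕ.⊔ K) m≥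
        n≥₁ = ℕ.m⊔n≤o⇒m≤o (Na ℕ.⊔ Nb) (N ℕ.⊔ K) n≥
        m≥₂ = ℕ.m⊔n≤o⇒n≤o (Na ℕ.⊔ Nb) (N ℕ.⊔ K) m≥
        n≥₂ = ℕ.m⊔n≤o⇒n≤o (Na ℕ.⊔ Nb) (N ℕ.⊔ K) n≥
    in begin-strict
    ℚ.∣ s m ℚ.* t m ℚ.- s n ℚ.* t n ∣
      ≡⟨ cong ℚ.∣_∣ (solve 4 (λ a b c d →
           a :* b :- c :* d := a :* (b :- d) :+ d :* (a :- c)) refl
           (s m) (t m) (s n) (t n)) ⟩
    ℚ.∣ s m ℚ.* (t m ℚ.- t n) ℚ.+ t n ℚ.* (s m ℚ.- s n) ∣
      ≤⟨ ℚ.∣p+q∣≤∣p∣+∣q∣ (s m ℚ.* (t m ℚ.- t n)) (t n ℚ.* (s m ℚ.- s n)) ⟩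
    ℚ.∣ s m ℚ.* (t m ℚ.- t n) ∣ ℚ.+ ℚ.∣ t n ℚ.* (s m ℚ.- s n) ∣
      <⟨ ℚ.+-mono-<
           (*-bound (s m) (t m ℚ.- t n) (hA m (ℕ.m⊔n≤o⇒m≤o Na Nb m≥₁)) 0<δ
             (ht m n (ℕ.m⊔n≤o⇒n≤o N K m≥₂) (ℕ.m⊔n≤o⇒n≤o N K n≥₂)))
           (*-bound (t n) (s m ℚ.- s n) (hB n (ℕ.m⊔n≤o⇒n≤o Na Nb n≥₁)) 0<δ
             (hs m n (ℕ.m⊔n≤o⇒m≤o N K m≥₂) (ℕ.m⊔n≤o⇒m≤o N K n≥₂))) ⟩
    A ℚ.* δ ℚ.+ B ℚ.* δ
      ≡⟨ sym (ℚ.*-distribʳ-+ δ A B) ⟩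
    (A ℚ.+ B) ℚ.* δ
      ≡⟨ eq ⟩
    ε ∎
    where open ℚ.≤-Reasoning

  ⊔-mono-<+ : ∀ p q p′ q′ {ε} → p ℚ.< p′ ℚ.+ ε → q ℚ.< q′ ℚ.+ ε →
    p ℚ.⊔ q ℚ.< (p′ ℚ.⊔ q′) ℚ.+ ε
  ⊔-mono-<+ p q p′ q′ {ε} h k with ℚ.≤-total p q
  ... | inj₁ p≤q = subst (ℚ._< (p′ ℚ.⊔ q′) ℚ.+ ε) (sym (ℚ.p≤q⇒p⊔q≡q p≤q))
    (ℚ.<-≤-trans k (ℚ.+-monoˡ-≤ ε (ℚ.p≤q⊔p p′ q′)))
  ... | inj₂ q≤p = subst (ℚ._< (p′ ℚ.⊔ q′) ℚ.+ ε) (sym (ℚ.p≥q⇒p⊔q≡p q≤p))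
    (ℚ.<-≤-trans h (ℚ.+-monoˡ-≤ ε (ℚ.p≤p⊔q p′ q′)))

  ⊔-cauchy : ∀ x y → IsCauchy (λ n → seq x n ℚ.⊔ seq y n)
  ⊔-cauchy (mkℝ s cs) (mkℝ t ct) ε 0<ε with cs ε 0<ε | ct ε 0<ε
  ... | N , hs | K , ht = N ℕ.⊔ K , λ m n m≥ n≥ →
    <⇒∣-∣< (s m ℚ.⊔ t m) (s n ℚ.⊔ t n) (half m n m≥ n≥) (half n m n≥ m≥)
    where
    half : ∀ m n → N ℕ.⊔ K ℕ.≤ m → N ℕ.⊔ K ℕ.≤ n →
      s m ℚ.⊔ t m ℚ.< (s n ℚ.⊔ t n) ℚ.+ ε
    half m n m≥ n≥ = ⊔-mono-<+ (s m) (t m) (s n) (t n)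
      (∣-∣<⇒< (s m) (s n)
        (hs m n (ℕ.m⊔n≤o⇒m≤o N K m≥) (ℕ.m⊔n≤o⇒m≤o N K n≥)))
      (∣-∣<⇒< (t m) (t n)
        (ht m n (ℕ.m⊔n≤o⇒n≤o N K m≥) (ℕ.m⊔n≤o⇒n≤o N K n≥)))

infixl 7 _*_
infixl 6 _+_ _-_ _⊔_
infix  8 -_

fromℕ : ℕ → ℝ
fromℕ k = mkℝ (λ _ → + k ℚ./ 1) (const-cauchy (+ k ℚ./ 1))

0ℝ 1ℝ : ℝ
0ℝ = fromℕ 0
1ℝ = fromℕ 1

_+_ : ℝ → ℝ → ℝ
x + y = mkℝ (λ n → seq x n ℚ.+ seq y n) (+-cauchy x y)

_*_ : ℝ → ℝ → ℝ
x * y = mkℝ (λ n → seq x n ℚ.* seq y n) (*-cauchy x y)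

_⊔_ : ℝ → ℝ → ℝ
x ⊔ y = mkℝ (λ n → seq x n ℚ.⊔ seq y n) (⊔-cauchy x y)

-_ : ℝ → ℝ
- x = mkℝ (λ n → ℚ.- seq x n) (neg-cauchy x)

_-_ : ℝ → ℝ → ℝ
_-_ x y = x + (- y)

∣_∣ : ℝ → ℝ
∣ x ∣ = x ⊔ (- x)

sum : ∀ {n} → Vector ℝ n → ℝ
sum = foldr _+_ 0ℝ

infix 7 _·_

_·_ : ∀ {n} → Vector ℝ n → Vector ℝ n → ℝ
u · v = sum (zipWith _*_ u v)

maximum : ∀ {n} .{{_ : ℕ.NonZero n}} → Vector ℝ n → ℝ
maximum {suc n} v = foldr _⊔_ (head v) (tail v)

------------------------------------------------------------------------
-- Binary points, the unit box and local minimizers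

Binary : ∀ {n} → Vector ℝ n → Set
Binary x = ∀ i → x i ≈ 0ℝ ⊎ x i ≈ 1ℝ

InBox : ∀ {n} → Vector ℝ n → Set
InBox x = ∀ i → 0ℝ ≤ x i × x i ≤ 1ℝ

-- The open sup-norm balls form a neighbourhood basis of the usual
-- topology on ℝⁿ.
Within : ∀ {n} → ℝ → Vector ℝ n → Vector ℝ n → Set
Within ε x x′ = ∀ i → ∣ x′ i - x i ∣ < ε

IsLocalMinimizer : ∀ {n k} → (Vector ℝ n → Vector ℝ k → ℝ) →
  Vector ℝ n → Vector ℝ k → Set
IsLocalMinimizer f x y =
  InBox x × InBox y ×
  ∃[ ε ] (0ℝ < ε ×
    (∀ x′ y′ → InBox x′ → InBox y′ → Within ε x x′ → Within ε y y′ →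
      f x y ≤ f x′ y′))

------------------------------------------------------------------------
-- The problem  max w·x  s.t.  a·x ≤ b, x ∈ {0,1}ⁿ  and its penalization

Feasible : ∀ {n} → Vector ℝ n → ℕ → Vector ℝ n → Set
Feasible a b x = Binary x × a · x ≤ fromℕ b

slack : ∀ {M} → Vector ℝ (suc M) → ℝ
slack y = (λ ℓ → fromℕ (2 ℕ.^ toℕ ℓ)) · y

residual : ∀ {n M} → Vector ℝ n → ℕ → Vector ℝ n → Vector ℝ (suc M) → ℝ
residual a b x y = a · x + slack y - fromℕ b

V-be : ∀ {n M} → Vector ℝ n → ℕ → Vector ℝ n → Vector ℝ (suc M) → ℝ
V-be a b x y = r * r - a · map (λ t → t * t) x + a · x
  where r = residual a b x y

f̂ : ∀ {n M} → Vector ℝ n → Vector ℝ n → ℕ → ℝ →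
  Vector ℝ n → Vector ℝ (suc M) → ℝ
f̂ w a b γ x y = - (w · x) + γ * V-be a b x y

{-# OPTIONS --safe #-}

-- Lowering a coordinate x i with a i = x i = 1 by q changes f̂ by exactly
-- − q ((γ − w i) + 2 γ (r − 1)); the terms in q² cancel because of the
-- correction − Σ a x² + Σ a x in V-be.  If x is binary and infeasible, then
-- a·x is an integer exceeding b, so such an i exists and, since the slack is
-- nonnegative, r ≥ 1.  As γ > w i the change is negative for every small
-- q > 0, contradicting local minimality.

module Submission where

open import Defs
open import Data.Empty using (⊥-elim)
open import Data.Fin.Base using (Fin; zero; suc; toℕ)
open import Data.Integer.Base as ℤ using (+_)
import Data.Integer.Properties as ℤ
open import Data.Nat.Base as ℕ using (ℕ; zero; suc; NonZero; z≤n; s≤s)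
import Data.Nat.Coprimality as Coprimality
import Data.Nat.Properties as ℕ
open import Data.Product.Base using (∃-syntax; _×_; _,_; proj₁; proj₂)
open import Data.Rational.Base as ℚ using (ℚ; 0ℚ; 1ℚ; ½)
import Data.Rational.Properties as ℚ
open import Data.Rational.Solver using (module +-*-Solver)
open import Data.Sum.Base using (_⊎_; inj₁; inj₂; [_,_]′)
open import Data.Vec.Base as Vec using (Vec; []; _∷_; lookup)
open import Data.Vec.Functional using (Vector; foldr; head; tail; map; updateAt; zipWith)
open import Data.Vec.Properties using (lookup-map)
open import Relation.Binary.PropositionalEquality
  using (_≡_; refl; sym; trans; cong; cong₂; subst; subst₂)
open import Relation.Nullary.Negation using (¬_)

open +-*-Solver

-- Rational inequalities

half-pos : ∀ {ε} → 0ℚ ℚ.< ε → 0ℚ ℚ.< ε ℚ.* ½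
half-pos = ℚ.*-monoˡ-<-pos ½

half+half : ∀ ε → ε ℚ.* ½ ℚ.+ ε ℚ.* ½ ≡ ε
half+half ε = trans (sym (ℚ.*-distribˡ-+ ε ½ ½)) (ℚ.*-identityʳ ε)

p<p+q : ∀ p {q} → 0ℚ ℚ.< q → p ℚ.< p ℚ.+ q
p<p+q p {q} 0<q = subst (ℚ._< p ℚ.+ q) (ℚ.+-identityʳ p) (ℚ.+-monoʳ-< p 0<q)

p≤∣p∣ : ∀ p → p ℚ.≤ ℚ.∣ p ∣
p≤∣p∣ p with ℚ.≤-total 0ℚ p
... | inj₁ 0≤p = ℚ.≤-reflexive (sym (ℚ.0≤p⇒∣p∣≡p 0≤p))
... | inj₂ p≤0 = ℚ.≤-trans p≤0 (ℚ.0≤∣p∣ p)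

0<p*q : ∀ {p q} → 0ℚ ℚ.< p → 0ℚ ℚ.< q → 0ℚ ℚ.< p ℚ.* q
0<p*q {p} {q} 0<p 0<q = ℚ.positive⁻¹ (p ℚ.* q)
  {{ℚ.pos*pos⇒pos p {{ℚ.positive 0<p}} q {{ℚ.positive 0<q}}}}

quotient : ∀ {c ε} → 0ℚ ℚ.< c → 0ℚ ℚ.< ε → ∃[ δ ] (0ℚ ℚ.< δ × c ℚ.* δ ≡ ε)
quotient {c} {ε} 0<c 0<ε = ℚ.1/ c ℚ.* ε
  , 0<p*q (ℚ.positive⁻¹ (ℚ.1/ c) {{ℚ.1/pos⇒pos c}}) 0<ε
  , trans (sym (ℚ.*-assoc c (ℚ.1/ c) ε))
      (trans (cong (ℚ._* ε) (ℚ.*-inverseʳ c)) (ℚ.*-identityˡ ε))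
  where
  instance
    c-pos = ℚ.positive 0<c
    c-nz  = ℚ.pos⇒nonZero c

-- Eventual properties and null sequences

eventually-map : ∀ {P Q : ℕ → Set} → (∀ n → P n → Q n) →
  Eventually P → Eventually Q
eventually-map f (N , h) = N , λ n N≤n → f n (h n N≤n)

eventually-zip : ∀ {P Q R : ℕ → Set} → (∀ n → P n → Q n → R n) →
  Eventually P → Eventually Q → Eventually R
eventually-zip f (N , h) (K , k) = N ℕ.⊔ K , λ n n≥ →
  f n (h n (ℕ.m⊔n≤o⇒m≤o N K n≥)) (k n (ℕ.m⊔n≤o⇒n≤o N K n≥))

-- `x ≈ y` unfolds to `Null` of the termwise difference, so each congruence law for `≈` reduces to
-- an algebraic rewriting of a difference and closure of null sequences.
Null : (ℕ → ℚ) → Set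
Null s = ∀ ε → 0ℚ ℚ.< ε → Eventually λ n → ℚ.∣ s n ∣ ℚ.< ε

null-resp : ∀ {s t} → (∀ n → s n ≡ t n) → Null s → Null t
null-resp eq h ε 0<ε =
  eventually-map (λ n → subst (λ p → ℚ.∣ p ∣ ℚ.< ε) (eq n)) (h ε 0<ε)

null-neg : ∀ {s} → Null s → Null (λ n → ℚ.- s n)
null-neg {s} h ε 0<ε =
  eventually-map (λ n → subst (ℚ._< ε) (sym (ℚ.∣-p∣≡∣p∣ (s n)))) (h ε 0<ε)

null-+ : ∀ {s t} → Null s → Null t → Null (λ n → s n ℚ.+ t n)
null-+ {s} {t} h k ε 0<ε = eventually-zip
  (λ n p q → ℚ.≤-<-trans (ℚ.∣p+q∣≤∣p∣+∣q∣ (s n) (t n))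
    (subst (ℚ.∣ s n ∣ ℚ.+ ℚ.∣ t n ∣ ℚ.<_) (half+half ε) (ℚ.+-mono-< p q)))
  (h (ε ℚ.* ½) (half-pos 0<ε)) (k (ε ℚ.* ½) (half-pos 0<ε))

bounded : ∀ x → ∃[ B ] (0ℚ ℚ.< B × Eventually λ n → ℚ.∣ seq x n ∣ ℚ.< B)
bounded (mkℝ s cs) with cs 1ℚ (ℚ.positive⁻¹ 1ℚ)
... | N , h = ℚ.∣ s N ∣ ℚ.+ 1ℚ
  , ℚ.+-mono-≤-< (ℚ.0≤∣p∣ (s N)) (ℚ.positive⁻¹ 1ℚ)
  , N , λ n N≤n → ℚ.≤-<-trans
      (subst (λ p → ℚ.∣ p ∣ ℚ.≤ ℚ.∣ s N ∣ ℚ.+ ℚ.∣ s n ℚ.- s N ∣)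
        (solve 2 (λ a b → b :+ (a :- b) := a) refl (s n) (s N))
        (ℚ.∣p+q∣≤∣p∣+∣q∣ (s N) (s n ℚ.- s N)))
      (ℚ.+-monoʳ-< ℚ.∣ s N ∣ (h n N N≤n ℕ.≤-refl))

-- A Cauchy sequence is eventually bounded by some `B`, so tolerance `ε / B` on the null factor is
-- enough.
null-* : ∀ x {t} → Null t → Null (λ n → seq x n ℚ.* t n)
null-* x {t} h ε 0<ε =
  let B , 0<B , xB     = bounded x
      δ , 0<δ , Bδ≡ε = quotient 0<B 0<ε
  in eventually-zip
  (λ n p q → subst₂ ℚ._<_ (sym (ℚ.∣p*q∣≡∣p∣*∣q∣ (seq x n) (t n))) Bδ≡ε
    (ℚ.≤-<-trans
      (ℚ.*-monoˡ-≤-nonNeg ℚ.∣ seq x n ∣ {{ℚ.∣-∣-nonNeg (seq x n)}} (ℚ.<⇒≤ q))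
      (ℚ.*-monoˡ-<-pos δ {{ℚ.positive 0<δ}} p)))
  xB (h δ 0<δ)

-- Equality, order and products of reals

-- _≈_, _≤_ and _<_ only mention the sequences, so that unification cannot
-- recover their arguments: the lemmas below are applied to explicit reals.
≗⇒≈ : ∀ {x y} → (∀ n → seq x n ≡ seq y n) → x ≈ y
≗⇒≈ {x} {y} eq ε 0<ε = 0 , λ n _ → subst (ℚ._< ε)
  (cong ℚ.∣_∣ (sym (trans (cong (ℚ._- seq y n) (eq n)) (ℚ.+-inverseʳ (seq y n)))))
  0<ε

≈-refl : ∀ {x} → x ≈ x
≈-refl {x} = ≗⇒≈ {x} {x} λ _ → refl

≈-sym : ∀ {x y} → x ≈ y → y ≈ x
≈-sym {x} {y} h = null-resp
  (λ n → solve 2 (λ a b → :- (a :- b) := b :- a) refl (seq x n) (seq y n))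
  (null-neg h)

≈-trans : ∀ {x y z} → x ≈ y → y ≈ z → x ≈ z
≈-trans {x} {y} {z} h k = null-resp
  (λ n → solve 3 (λ a b c → (a :- b) :+ (b :- c) := a :- c) refl
    (seq x n) (seq y n) (seq z n))
  (null-+ h k)

+-cong : ∀ {x x′ y y′} → x ≈ x′ → y ≈ y′ → x + y ≈ x′ + y′
+-cong {x} {x′} {y} {y′} h k = null-resp
  (λ n → solve 4 (λ a b c d → (a :- b) :+ (c :- d) := (a :+ c) :- (b :+ d)) refl
    (seq x n) (seq x′ n) (seq y n) (seq y′ n))
  (null-+ h k)

-‿cong : ∀ {x y} → x ≈ y → - x ≈ - y
-‿cong {x} {y} h = null-resp
  (λ n → solve 2 (λ a b → :- (a :- b) := (:- a) :- (:- b)) refl (seq x n) (seq y n))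
  (null-neg h)

*-cong : ∀ {x x′ y y′} → x ≈ x′ → y ≈ y′ → x * y ≈ x′ * y′
*-cong {x} {x′} {y} {y′} h k = null-resp
  (λ n → solve 4 (λ a b c d →
      a :* (c :- d) :+ d :* (a :- b) := a :* c :- b :* d) refl
    (seq x n) (seq x′ n) (seq y n) (seq y′ n))
  (null-+ (null-* x k) (null-* y′ h))

pointwise-≤ : ∀ {x y} → (∀ n → seq x n ℚ.≤ seq y n) → x ≤ y
pointwise-≤ {x} {y} h ε 0<ε = 0 , λ n _ → ℚ.≤-<-trans (h n) (p<p+q (seq y n) 0<ε)

≈⇒≤ : ∀ {x y} → x ≈ y → x ≤ y
≈⇒≤ {x} {y} h ε 0<ε = eventually-map
  (λ n p → subst (ℚ._< seq y n ℚ.+ ε)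
    (solve 2 (λ a b → b :+ (a :- b) := a) refl (seq x n) (seq y n))
    (ℚ.+-monoʳ-< (seq y n) (ℚ.≤-<-trans (p≤∣p∣ (seq x n ℚ.- seq y n)) p)))
  (h ε 0<ε)

≤-trans : ∀ {x y z} → x ≤ y → y ≤ z → x ≤ z
≤-trans {x} {y} {z} h k ε 0<ε = eventually-zip
  (λ n p q → ℚ.<-trans p (subst (seq y n ℚ.+ ε ℚ.* ½ ℚ.<_)
    (trans (ℚ.+-assoc (seq z n) _ _) (cong (seq z n ℚ.+_) (half+half ε)))
    (ℚ.+-monoˡ-< (ε ℚ.* ½) q)))
  (h (ε ℚ.* ½) (half-pos 0<ε)) (k (ε ℚ.* ½) (half-pos 0<ε))

p+q+q<r+q⇒p+q<r : ∀ p q r → p ℚ.+ (q ℚ.+ q) ℚ.< r ℚ.+ q → p ℚ.+ q ℚ.< r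
p+q+q<r+q⇒p+q<r p q r h = subst₂ ℚ._<_
  (solve 2 (λ p q → (p :+ (q :+ q)) :- q := p :+ q) refl p q)
  (solve 2 (λ r q → (r :+ q) :- q := r) refl r q)
  (ℚ.+-monoˡ-< (ℚ.- q) h)

-- Half of the uniform gap absorbs the tolerance allowed by `≤`; the other half survives as the new
-- gap. The mirrored law below splits the gap in the same way.
<-≤-trans : ∀ {x y z} → x < y → y ≤ z → x < z
<-≤-trans {x} {y} {z} (ε , 0<ε , h) k = ε ℚ.* ½ , half-pos 0<ε , eventually-zip
  (λ n p q → p+q+q<r+q⇒p+q<r (seq x n) (ε ℚ.* ½) (seq z n)
    (ℚ.<-trans
      (subst (λ δ → seq x n ℚ.+ δ ℚ.< seq y n) (sym (half+half ε)) p) q))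
  h (k (ε ℚ.* ½) (half-pos 0<ε))

≤-<-trans : ∀ {x y z} → x ≤ y → y < z → x < z
≤-<-trans {x} {y} {z} h (ε , 0<ε , k) = ε ℚ.* ½ , half-pos 0<ε , eventually-zip
  (λ n p q → ℚ.<-trans (ℚ.+-monoˡ-< (ε ℚ.* ½) p)
    (subst (ℚ._< seq z n)
      (sym (trans (ℚ.+-assoc (seq y n) _ _) (cong (seq y n ℚ.+_) (half+half ε))))
      q))
  (h (ε ℚ.* ½) (half-pos 0<ε)) k

<⇒≤ : ∀ {x y} → x < y → x ≤ y
<⇒≤ {x} {y} (δ , 0<δ , h) ε 0<ε = eventually-map
  (λ n p → ℚ.<-trans (ℚ.<-trans (p<p+q (seq x n) 0<δ) p) (p<p+q (seq y n) 0<ε)) h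

<-irrefl : ∀ {x} → ¬ (x < x)
<-irrefl {x} (ε , 0<ε , N , h) =
  ℚ.<-irrefl refl (ℚ.<-trans (p<p+q (seq x N) 0<ε) (h N ℕ.≤-refl))

x≤x+y : ∀ {x y} → 0ℝ ≤ y → x ≤ x + y
x≤x+y {x} {y} h ε 0<ε = eventually-map
  (λ n p → subst₂ ℚ._<_ (ℚ.+-identityʳ (seq x n))
    (sym (ℚ.+-assoc (seq x n) (seq y n) ε)) (ℚ.+-monoʳ-< (seq x n) p))
  (h ε 0<ε)

x<x+y : ∀ {x y} → 0ℝ < y → x < x + y
x<x+y {x} {y} (ε , 0<ε , h) = ε , 0<ε , eventually-map
  (λ n p → ℚ.+-monoʳ-< (seq x n) (subst (ℚ._< seq y n) (ℚ.+-identityˡ ε) p)) h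

x≤y⇒0≤y-x : ∀ {x y} → x ≤ y → 0ℝ ≤ y - x
x≤y⇒0≤y-x {x} {y} h ε 0<ε = eventually-map
  (λ n p → subst₂ ℚ._<_ (ℚ.+-inverseʳ (seq x n))
    (solve 3 (λ a b e → (b :+ e) :- a := (b :- a) :+ e) refl (seq x n) (seq y n) ε)
    (ℚ.+-monoˡ-< (ℚ.- seq x n) p))
  (h ε 0<ε)

x<y⇒0<y-x : ∀ {x y} → x < y → 0ℝ < y - x
x<y⇒0<y-x {x} {y} (ε , 0<ε , h) = ε , 0<ε , eventually-map
  (λ n p → subst (ℚ._< seq y n ℚ.- seq x n)
    (solve 2 (λ a e → (a :+ e) :- a := con 0ℚ :+ e) refl (seq x n) ε)
    (ℚ.+-monoˡ-< (ℚ.- seq x n) p))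
  h

0<x⇒-x<0 : ∀ {x} → 0ℝ < x → - x < 0ℝ
0<x⇒-x<0 {x} (ε , 0<ε , h) = ε , 0<ε , eventually-map
  (λ n p → subst₂ ℚ._<_
    (solve 2 (λ a e → (con 0ℚ :+ e) :- a := (:- a) :+ e) refl (seq x n) ε)
    (ℚ.+-inverseʳ (seq x n))
    (ℚ.+-monoˡ-< (ℚ.- seq x n) p))
  h

*-pos : ∀ {x y} → 0ℝ < x → 0ℝ < y → 0ℝ < x * y
*-pos {x} {y} (ε , 0<ε , h) (δ , 0<δ , k) = ε ℚ.* δ , 0<p*q 0<ε 0<δ
  , eventually-zip
  (λ n p q → subst (ℚ._< seq x n ℚ.* seq y n) (sym (ℚ.+-identityˡ (ε ℚ.* δ)))
    (product-< (subst (ℚ._< seq x n) (ℚ.+-identityˡ ε) p)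
               (subst (ℚ._< seq y n) (ℚ.+-identityˡ δ) q)))
  h k
  where
  product-< : ∀ {p q} → ε ℚ.< p → δ ℚ.< q → ε ℚ.* δ ℚ.< p ℚ.* q
  product-< {p} ε<p δ<q = ℚ.<-trans
    (ℚ.*-monoˡ-<-pos δ {{ℚ.positive 0<δ}} ε<p)
    (ℚ.*-monoʳ-<-pos p {{ℚ.positive (ℚ.<-trans 0<ε ε<p)}} δ<q)

-- Terms `q` of `y` may be slightly negative, but `q + δ` is positive, and the terms `p` of `x` are
-- eventually positive and below `B`. Hence `0 < p (q + δ) < p q + B δ`, and `δ` is chosen with
-- `B δ = ε`.
pos*nonneg : ∀ {x y} → 0ℝ < x → 0ℝ ≤ y → 0ℝ ≤ x * y
pos*nonneg {x} {y} (η , 0<η , h) k ε 0<ε =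
  let B , 0<B , xB     = bounded x
      δ , 0<δ , Bδ≡ε = quotient 0<B 0<ε
  in eventually-zip
  (λ n p q → bound 0<δ Bδ≡ε p (proj₁ q) (proj₂ q)) h
  (eventually-zip (λ n → _,_) xB (k δ 0<δ))
  where
  bound : ∀ {p q B δ} → 0ℚ ℚ.< δ → B ℚ.* δ ≡ ε →
    0ℚ ℚ.+ η ℚ.< p → ℚ.∣ p ∣ ℚ.< B → 0ℚ ℚ.< q ℚ.+ δ → 0ℚ ℚ.< p ℚ.* q ℚ.+ ε
  bound {p} {q} {B} {δ} 0<δ Bδ≡ε η<p p<B 0<q+δ = ℚ.<-trans (0<p*q 0<p 0<q+δ)
    (subst₂ ℚ._<_ (sym (ℚ.*-distribˡ-+ p q δ)) (cong (p ℚ.* q ℚ.+_) Bδ≡ε)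
      (ℚ.+-monoʳ-< (p ℚ.* q)
        (ℚ.*-monoˡ-<-pos δ {{ℚ.positive 0<δ}} (ℚ.≤-<-trans (p≤∣p∣ p) p<B))))
    where
    0<p = ℚ.<-trans (subst (0ℚ ℚ.<_) (sym (ℚ.+-identityˡ η)) 0<η) η<p

⊔-lub-< : ∀ {x y z} → x < z → y < z → x ⊔ y < z
⊔-lub-< {x} {y} {z} (ε , 0<ε , h) (δ , 0<δ , k) = ε ℚ.⊓ δ
  , [ (λ e → subst (0ℚ ℚ.<_) (sym e) 0<ε) , (λ e → subst (0ℚ ℚ.<_) (sym e) 0<δ) ]′
      (ℚ.⊓-sel ε δ)
  , eventually-zip
  (λ n p q →
    [ (λ e → subst (λ m → m ℚ.+ (ε ℚ.⊓ δ) ℚ.< seq z n) (sym e)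
        (ℚ.≤-<-trans (ℚ.+-monoʳ-≤ (seq x n) (ℚ.p⊓q≤p ε δ)) p))
    , (λ e → subst (λ m → m ℚ.+ (ε ℚ.⊓ δ) ℚ.< seq z n) (sym e)
        (ℚ.≤-<-trans (ℚ.+-monoʳ-≤ (seq y n) (ℚ.p⊓q≤q ε δ)) q)) ]′
    (ℚ.⊔-sel (seq x n) (seq y n)))
  h k

-- Rational and natural constants as reals

fromℚ : ℚ → ℝ
fromℚ p = mkℝ (λ _ → p) λ ε 0<ε → 0 , λ _ _ _ _ →
  subst (ℚ._< ε) (sym (cong ℚ.∣_∣ (ℚ.+-inverseʳ p))) 0<ε

fromℚ-pos : ∀ {p} → 0ℚ ℚ.< p → 0ℝ < fromℚ p
fromℚ-pos {p} 0<p = p ℚ.* ½ , half-pos 0<p , 0 , λ _ _ →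
  subst₂ ℚ._<_ (sym (ℚ.+-identityˡ (p ℚ.* ½))) (half+half p)
    (p<p+q (p ℚ.* ½) (half-pos 0<p))

-- With gap `δ` of `x` above 0, half of `min(δ, 1)` works: its double is at most `δ`, so `q` itself
-- serves as the gap between `q` and `x`.
small-positive : ∀ {x} → 0ℝ < x →
  ∃[ q ] (0ℚ ℚ.< q × q ℚ.≤ 1ℚ × fromℚ q < x)
small-positive {x} (δ , 0<δ , h) = q , 0<q
  , ℚ.≤-trans (ℚ.<⇒≤ q<m) (ℚ.p⊓q≤q δ 1ℚ)
  , q , 0<q , eventually-map
      (λ n p → ℚ.≤-<-trans
        (subst (ℚ._≤ 0ℚ ℚ.+ δ) (sym (half+half m))
          (subst (m ℚ.≤_) (sym (ℚ.+-identityˡ δ)) (ℚ.p⊓q≤p δ 1ℚ))) p)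
      h
  where
  m = δ ℚ.⊓ 1ℚ
  q = m ℚ.* ½
  0<q : 0ℚ ℚ.< q
  0<q = half-pos ([ (λ e → subst (0ℚ ℚ.<_) (sym e) 0<δ)
                  , (λ e → subst (0ℚ ℚ.<_) (sym e) (ℚ.positive⁻¹ 1ℚ)) ]′
                  (ℚ.⊓-sel δ 1ℚ))
  q<m : q ℚ.< m
  q<m = subst (q ℚ.<_) (half+half m) (p<p+q q 0<q)

-- The gcd inside `/` does not reduce for a variable `k`. Coprimality with 1 puts `+ k / 1` in
-- constructor form, after which rational addition computes.
suc/1 : ∀ k → + suc k ℚ./ 1 ≡ 1ℚ ℚ.+ + k ℚ./ 1
suc/1 k = trans
  (cong (ℚ._/ 1) (cong (λ i → + 1 ℤ.+ i) (sym (ℤ.*-identityʳ (+ k)))))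
  (cong (1ℚ ℚ.+_)
    (sym (ℚ.normalize-coprime (Coprimality.sym (Coprimality.1-coprimeTo k)))))

/1-mono-≤ : ∀ {k l} → k ℕ.≤ l → + k ℚ./ 1 ℚ.≤ + l ℚ./ 1
/1-mono-≤ {l = l} z≤n = ℚ.nonNegative⁻¹ (+ l ℚ./ 1) {{ℚ.normalize-nonNeg l 1}}
/1-mono-≤ {suc k} {suc l} (s≤s k≤l) = subst₂ ℚ._≤_ (sym (suc/1 k)) (sym (suc/1 l))
  (ℚ.+-monoʳ-≤ 1ℚ (/1-mono-≤ k≤l))

fromℕ-mono-≤ : ∀ {k l} → k ℕ.≤ l → fromℕ k ≤ fromℕ l
fromℕ-mono-≤ {k} {l} k≤l =
  pointwise-≤ {fromℕ k} {fromℕ l} λ _ → /1-mono-≤ k≤l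

fromℕ-suc : ∀ k → fromℕ (suc k) ≈ 1ℝ + fromℕ k
fromℕ-suc k = ≗⇒≈ {fromℕ (suc k)} {1ℝ + fromℕ k} λ _ → suc/1 k

fromℕ-pos : ∀ k .{{_ : NonZero k}} → 0ℝ < fromℕ k
fromℕ-pos k = fromℚ-pos (ℚ.positive⁻¹ (+ k ℚ./ 1) {{ℚ.normalize-pos k 1}})

+-identityˡ : ∀ x → 0ℝ + x ≈ x
+-identityˡ x = ≗⇒≈ {0ℝ + x} {x} λ n → ℚ.+-identityˡ (seq x n)

≈0*-≈0 : ∀ {x y} → x ≈ 0ℝ → x * y ≈ 0ℝ
≈0*-≈0 {x} {y} h = ≈-trans {x * y} {0ℝ * y} {0ℝ}
  (*-cong {x} {0ℝ} {y} {y} h (≈-refl {y}))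
  (≗⇒≈ {0ℝ * y} {0ℝ} λ n → ℚ.*-zeroˡ (seq y n))

*≈0-≈0 : ∀ {x y} → y ≈ 0ℝ → x * y ≈ 0ℝ
*≈0-≈0 {x} {y} h = ≈-trans {x * y} {x * 0ℝ} {0ℝ}
  (*-cong {x} {x} {y} {0ℝ} (≈-refl {x}) h)
  (≗⇒≈ {x * 0ℝ} {0ℝ} λ n → ℚ.*-zeroʳ (seq x n))

1*1≈1 : ∀ {x y} → x ≈ 1ℝ → y ≈ 1ℝ → x * y ≈ 1ℝ
1*1≈1 {x} {y} h k = ≈-trans {x * y} {x * 1ℝ} {1ℝ}
  (*-cong {x} {x} {y} {1ℝ} (≈-refl {x}) k)
  (≈-trans {x * 1ℝ} {x} {1ℝ}
    (≗⇒≈ {x * 1ℝ} {x} λ n → ℚ.*-identityʳ (seq x n)) h)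

0+fromℕ : ∀ {x y} k → x ≈ 0ℝ → y ≈ fromℕ k → x + y ≈ fromℕ k
0+fromℕ {x} {y} k h h′ = ≈-trans {x + y} {0ℝ + fromℕ k} {fromℕ k}
  (+-cong {x} {0ℝ} {y} {fromℕ k} h h′) (+-identityˡ (fromℕ k))

1+fromℕ : ∀ {x y} k → x ≈ 1ℝ → y ≈ fromℕ k → x + y ≈ fromℕ (suc k)
1+fromℕ {x} {y} k h h′ = ≈-trans {x + y} {1ℝ + fromℕ k} {fromℕ (suc k)}
  (+-cong {x} {1ℝ} {y} {fromℕ k} h h′)
  (≈-sym {fromℕ (suc k)} {1ℝ + fromℕ k} (fromℕ-suc k))

-- Folds and the effect of changing one entry

-- Facts about sum and maximum are instances of facts about foldr over an
-- arbitrary operation, as unfolding + and ⊔ down to ℚ makes conversion checks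
-- explode; Identities below is abstract in the ring operations for the same
-- reason.
module _ {A : Set} (_∙_ : A → A → A) where

  foldr-elim : ∀ {n} (P : A → Set) e (v : Vector A n) →
    P e → (∀ i {s} → P s → P (v i ∙ s)) → P (foldr _∙_ e v)
  foldr-elim {zero}  P e v base step = base
  foldr-elim {suc n} P e v base step =
    step zero (foldr-elim P e (tail v) base (λ i → step (suc i)))

  foldr-lookup : ∀ {n} (P : A → Set) e (v : Vector A n) i →
    (∀ s → P (v i ∙ s)) → (∀ z {s} → P s → P (z ∙ s)) → P (foldr _∙_ e v)
  foldr-lookup P e v zero    base step = base (foldr _∙_ e (tail v))
  foldr-lookup P e v (suc i) base step =
    step (v zero) (foldr-lookup P e (tail v) i base step)

  foldr-updateAt : ∀ {B C : Set} (_⋆_ : B → C → A) {n} (R : A → A → Set) e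
    (u : Vector B n) (x : Vector C n) i f →
    (∀ s → R ((u i ⋆ x i) ∙ s) ((u i ⋆ f (x i)) ∙ s)) →
    (∀ z s s′ → R s s′ → R (z ∙ s) (z ∙ s′)) →
    R (foldr _∙_ e (zipWith _⋆_ u x)) (foldr _∙_ e (zipWith _⋆_ u (updateAt x i f)))
  foldr-updateAt _⋆_ R e u x zero    f base step =
    base (foldr _∙_ e (zipWith _⋆_ (tail u) (tail x)))
  foldr-updateAt _⋆_ R e u x (suc i) f base step = step (u zero ⋆ x zero) _ _
    (foldr-updateAt _⋆_ R e (tail u) (tail x) i f base step)

  -- Since `map` acts pointwise, `g` can be absorbed into the operation, and the claim is an
  -- instance of the previous one by computation.
  foldr-map-updateAt : ∀ {B C D : Set} (_⋆_ : B → D → A) (g : C → D) {n}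
    (R : A → A → Set) e (u : Vector B n) (x : Vector C n) i f →
    (∀ s → R ((u i ⋆ g (x i)) ∙ s) ((u i ⋆ g (f (x i))) ∙ s)) →
    (∀ z s s′ → R s s′ → R (z ∙ s) (z ∙ s′)) →
    R (foldr _∙_ e (zipWith _⋆_ u (map g x)))
      (foldr _∙_ e (zipWith _⋆_ u (map g (updateAt x i f))))
  foldr-map-updateAt _⋆_ g = foldr-updateAt (λ b c → b ⋆ g c)

-- Sums and dot products of binary vectors

sum-binary : ∀ {n} (P : Fin n → Set) (v : Vector ℝ n) →
  (∀ i → v i ≈ 0ℝ ⊎ (v i ≈ 1ℝ × P i)) →
  ∃[ k ] (sum v ≈ fromℕ k × (k ≡ 0 ⊎ ∃[ i ] P i))
sum-binary P v v∈ = foldr-elim _+_ Q 0ℝ v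
  (0 , ≈-refl {0ℝ} , inj₁ refl) (λ i {s} → step i {s} (v∈ i))
  where
  Q : ℝ → Set
  Q s = ∃[ k ] (s ≈ fromℕ k × (k ≡ 0 ⊎ ∃[ i ] P i))

  step : ∀ i {s} → v i ≈ 0ℝ ⊎ (v i ≈ 1ℝ × P i) → Q s → Q (v i + s)
  step i {s} (inj₁ v≈0) (k , eq , support) =
    k , 0+fromℕ {v i} {s} k v≈0 eq , support
  step i {s} (inj₂ (v≈1 , p)) (k , eq , _) =
    suc k , 1+fromℕ {v i} {s} k v≈1 eq , inj₂ (i , p)

-- A product of two bits is 1 only if both are. The last component records an index responsible for
-- a nonzero count; this is the coordinate lowered later.
dot-binary : ∀ {n} (a x : Vector ℝ n) → Binary a → Binary x →
  ∃[ k ] (a · x ≈ fromℕ k × (k ≡ 0 ⊎ ∃[ i ] (a i ≈ 1ℝ × x i ≈ 1ℝ)))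
dot-binary a x a∈ x∈ = sum-binary (λ i → a i ≈ 1ℝ × x i ≈ 1ℝ) (zipWith _*_ a x)
  λ i → product i (a∈ i) (x∈ i)
  where
  product : ∀ i → a i ≈ 0ℝ ⊎ a i ≈ 1ℝ → x i ≈ 0ℝ ⊎ x i ≈ 1ℝ →
    a i * x i ≈ 0ℝ ⊎ (a i * x i ≈ 1ℝ × a i ≈ 1ℝ × x i ≈ 1ℝ)
  product i (inj₁ a≈0) _          = inj₁ (≈0*-≈0 {a i} {x i} a≈0)
  product i (inj₂ _)   (inj₁ x≈0) = inj₁ (*≈0-≈0 {a i} {x i} x≈0)
  product i (inj₂ a≈1) (inj₂ x≈1) = inj₂ (1*1≈1 {a i} {x i} a≈1 x≈1 , a≈1 , x≈1)

-- Polynomial identities by reflection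

infixl 6 _⊕_ _⊝_
infixl 7 _⊗_
infix  8 ⊖_

-- One syntax with two readings: as solver polynomials over ℚ, and through `eval` in any structure
-- with these operations. Identities are decided in the first reading and used in the second.
data Expr (m : ℕ) : Set where
  var : Fin m → Expr m
  𝟙   : Expr m
  _⊕_ _⊝_ _⊗_ : Expr m → Expr m → Expr m
  ⊖_  : Expr m → Expr m

polynomial : ∀ {m} → Expr m → Polynomial m
polynomial (var i) = var i
polynomial 𝟙       = con 1ℚ
polynomial (e ⊕ f) = polynomial e :+ polynomial f
polynomial (e ⊝ f) = polynomial e :- polynomial f
polynomial (e ⊗ f) = polynomial e :* polynomial f
polynomial (⊖ e)   = :- polynomial e

-- Agreement of the solver's normal forms, the premise of `prove`; it is `refl` for every identity
-- below.
_≐_ : ∀ {m} → Expr m → Expr m → Set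
e ≐ f = ∀ σ → ⟦ polynomial e ⟧↓ σ ≡ ⟦ polynomial f ⟧↓ σ

module Evaluation {A : Set} (_+′_ _-′_ _*′_ : A → A → A) (-′_ : A → A) (1′ : A) where

  eval : ∀ {m} → Expr m → Vec A m → A
  eval (var i) ρ = lookup ρ i
  eval 𝟙       ρ = 1′
  eval (e ⊕ f) ρ = eval e ρ +′ eval f ρ
  eval (e ⊝ f) ρ = eval e ρ -′ eval f ρ
  eval (e ⊗ f) ρ = eval e ρ *′ eval f ρ
  eval (⊖ e)   ρ = -′ eval e ρ

  module Identities
    (_≈′_ : A → A → Set)
    (valid : ∀ {m} (e f : Expr m) → e ≐ f → ∀ ρ → eval e ρ ≈′ eval f ρ) where

    private
      v₀ : ∀ {m} → Expr (1 ℕ.+ m)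
      v₀ = var zero
      v₁ : ∀ {m} → Expr (2 ℕ.+ m)
      v₁ = var (suc zero)
      v₂ : ∀ {m} → Expr (3 ℕ.+ m)
      v₂ = var (suc (suc zero))
      v₃ : ∀ {m} → Expr (4 ℕ.+ m)
      v₃ = var (suc (suc (suc zero)))
      v₄ : ∀ {m} → Expr (5 ℕ.+ m)
      v₄ = var (suc (suc (suc (suc zero))))
      v₅ : ∀ {m} → Expr (6 ℕ.+ m)
      v₅ = var (suc (suc (suc (suc (suc zero)))))
      v₆ : ∀ {m} → Expr (7 ℕ.+ m)
      v₆ = var (suc (suc (suc (suc (suc (suc zero))))))
      v₇ : ∀ {m} → Expr (8 ℕ.+ m)
      v₇ = var (suc (suc (suc (suc (suc (suc (suc zero)))))))

    replace-term : ∀ u p q s →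
      ((u *′ q) +′ s) ≈′ (((u *′ p) +′ s) +′ (u *′ (q -′ p)))
    replace-term u p q s = valid
      (v₀ ⊗ v₂ ⊕ v₃) ((v₀ ⊗ v₁ ⊕ v₃) ⊕ v₀ ⊗ (v₂ ⊝ v₁))
      (λ _ → refl) (u ∷ p ∷ q ∷ s ∷ [])

    +-assoc : ∀ x y z → (x +′ (y +′ z)) ≈′ ((x +′ y) +′ z)
    +-assoc x y z = valid (v₀ ⊕ (v₁ ⊕ v₂)) ((v₀ ⊕ v₁) ⊕ v₂)
      (λ _ → refl) (x ∷ y ∷ z ∷ [])

    x-x≈-[x-x] : ∀ x → (x -′ x) ≈′ (-′ (x -′ x))
    x-x≈-[x-x] x = valid (v₀ ⊝ v₀) (⊖ (v₀ ⊝ v₀)) (λ _ → refl) (x ∷ [])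

    [1-q]-1≈-q : ∀ q → ((1′ -′ q) -′ 1′) ≈′ (-′ q)
    [1-q]-1≈-q q = valid ((𝟙 ⊝ v₀) ⊝ 𝟙) (⊖ v₀) (λ _ → refl) (q ∷ [])

    neg-involutive : ∀ q → (-′ (-′ q)) ≈′ q
    neg-involutive q = valid (⊖ (⊖ v₀)) v₀ (λ _ → refl) (q ∷ [])

    -- The factors `1′` are the values of `a i` and of the old `x i`. The step changes `r²` by -2qr
    -- + q², `−Q` by 2q - q² and `A` by -q, in total -q(1 + 2(r - 1)); the linear part adds qω. The
    -- factor 2 appears as a repeated summand because `𝟙` is the only constant of `Expr`.
    descent : ∀ γ ω q W A Q S B →
      let d  = (1′ -′ q) -′ 1′
          A₁ = A +′ (1′ *′ d)
          Q₁ = Q +′ (1′ *′ (((1′ -′ q) *′ (1′ -′ q)) -′ (1′ *′ 1′)))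
          r  = (A +′ S) -′ B
          r₁ = (A₁ +′ S) -′ B
      in ((-′ W) +′ (γ *′ (((r *′ r) -′ Q) +′ A))) ≈′
         (((-′ (W +′ (ω *′ d))) +′ (γ *′ (((r₁ *′ r₁) -′ Q₁) +′ A₁)))
          +′ (q *′ ((γ -′ ω) +′ (γ *′ ((r -′ 1′) +′ (r -′ 1′))))))
    descent γ ω q W A Q S B = valid
      (⊖ v₃ ⊕ v₀ ⊗ (r ⊗ r ⊝ v₅ ⊕ v₄))
      (⊖ (v₃ ⊕ v₁ ⊗ d) ⊕ v₀ ⊗ (r₁ ⊗ r₁ ⊝ Q₁ ⊕ A₁)
       ⊕ v₂ ⊗ ((v₀ ⊝ v₁) ⊕ v₀ ⊗ ((r ⊝ 𝟙) ⊕ (r ⊝ 𝟙))))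
      (λ _ → refl) (γ ∷ ω ∷ q ∷ W ∷ A ∷ Q ∷ S ∷ B ∷ [])
      where
      d A₁ Q₁ r r₁ : Expr 8
      d  = (𝟙 ⊝ v₂) ⊝ 𝟙
      A₁ = v₄ ⊕ 𝟙 ⊗ d
      Q₁ = v₅ ⊕ 𝟙 ⊗ ((𝟙 ⊝ v₂) ⊗ (𝟙 ⊝ v₂) ⊝ 𝟙 ⊗ 𝟙)
      r  = v₄ ⊕ v₆ ⊝ v₇
      r₁ = A₁ ⊕ v₆ ⊝ v₇

open Evaluation _+_ _-_ _*_ -_ 1ℝ

-- The real operations act termwise, so an identity of reals can be checked at each index by the
-- rational solver.
seq-eval : ∀ {m} (e : Expr m) ρ k →
  seq (eval e ρ) k ≡ ⟦ polynomial e ⟧ (Vec.map (λ x → seq x k) ρ)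
seq-eval (var i) ρ k = sym (lookup-map i (λ x → seq x k) ρ)
seq-eval 𝟙       ρ k = refl
seq-eval (e ⊕ f) ρ k = cong₂ ℚ._+_ (seq-eval e ρ k) (seq-eval f ρ k)
seq-eval (e ⊝ f) ρ k = cong₂ ℚ._-_ (seq-eval e ρ k) (seq-eval f ρ k)
seq-eval (e ⊗ f) ρ k = cong₂ ℚ._*_ (seq-eval e ρ k) (seq-eval f ρ k)
seq-eval (⊖ e)   ρ k = cong ℚ.-_ (seq-eval e ρ k)

valid : ∀ {m} (e f : Expr m) → e ≐ f → ∀ ρ → eval e ρ ≈ eval f ρ
valid e f eq ρ = ≗⇒≈ {eval e ρ} {eval f ρ} λ k →
  let σ = Vec.map (λ x → seq x k) ρ
  in trans (seq-eval e ρ k)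
      (trans (prove σ (polynomial e) (polynomial f) (eq σ)) (sym (seq-eval f ρ k)))

open Identities _≈_ valid

-- Changing one coordinate; bounds on dot products and maxima

module _ {n} (u : Vector ℝ n) (x : Vector ℝ n) (i : Fin n) (f : ℝ → ℝ) where

  private
    Shifted : ℝ → ℝ → ℝ → Set
    Shifted d s s′ = s′ ≈ s + d

    -- Entries in front of the changed one pass the shift on unaltered, by associativity.
    shifted-+ : ∀ d z s s′ → Shifted d s s′ → Shifted d (z + s) (z + s′)
    shifted-+ d z s s′ eq = ≈-trans {z + s′} {z + (s + d)} {z + s + d}
      (+-cong {z} {z} {s′} {s + d} (≈-refl {z}) eq) (+-assoc z s d)

  dot-updateAt : u · updateAt x i f ≈ u · x + u i * (f (x i) - x i)
  dot-updateAt = foldr-updateAt _+_ _*_ (Shifted (u i * (f (x i) - x i))) 0ℝ u x i f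
    (replace-term (u i) (x i) (f (x i))) (shifted-+ (u i * (f (x i) - x i)))

  dot-map-updateAt : ∀ g →
    u · map g (updateAt x i f) ≈ u · map g x + u i * (g (f (x i)) - g (x i))
  dot-map-updateAt g = foldr-map-updateAt _+_ _*_ g
    (Shifted (u i * (g (f (x i)) - g (x i)))) 0ℝ u x i f
    (replace-term (u i) (g (x i)) (g (f (x i))))
    (shifted-+ (u i * (g (f (x i)) - g (x i))))

-- The predicate depends on the index because membership in a ball compares each entry with the
-- centre's entry at the same position.
updateAt-elim : ∀ {n} {A : Set} (P : Fin n → A → Set) (x : Vector A n) i f →
  P i (f (x i)) → (∀ j → P j (x j)) → ∀ j → P j (updateAt x i f j)
updateAt-elim P x zero    f p q zero    = p
updateAt-elim P x zero    f p q (suc j) = q (suc j)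
updateAt-elim P x (suc i) f p q zero    = q zero
updateAt-elim P x (suc i) f p q (suc j) =
  updateAt-elim (λ j → P (suc j)) (tail x) i f p (λ j → q (suc j)) j

dot-nonneg : ∀ {n} (u y : Vector ℝ n) → (∀ i → 0ℝ < u i) → (∀ i → 0ℝ ≤ y i) →
  0ℝ ≤ u · y
dot-nonneg u y u> y≥ = foldr-elim _+_ (0ℝ ≤_) 0ℝ (zipWith _*_ u y)
  (pointwise-≤ {0ℝ} {0ℝ} λ _ → ℚ.≤-refl)
  λ i {s} 0≤s → ≤-trans {0ℝ} {u i * y i} {u i * y i + s}
    (pos*nonneg {u i} {y i} (u> i) (y≥ i)) (x≤x+y {u i * y i} {s} 0≤s)

-- The fold starts from `head v`, so the first entry is the innermost argument and is bounded
-- through the start value; any other entry is met on the way.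
lookup≤maximum : ∀ {n} .{{_ : NonZero n}} (v : Vector ℝ n) i → v i ≤ maximum v
lookup≤maximum {suc n} v zero = pointwise-≤ {head v} {maximum v} λ k →
  foldr-elim _⊔_ (λ s → seq (head v) k ℚ.≤ seq s k) (head v) (tail v) ℚ.≤-refl
    λ i {s} h → ℚ.≤-trans h (ℚ.p≤q⊔p (seq (tail v i) k) (seq s k))
lookup≤maximum {suc n} v (suc i) = pointwise-≤ {tail v i} {maximum v} λ k →
  foldr-lookup _⊔_ (λ s → seq (tail v i) k ℚ.≤ seq s k) (head v) (tail v) i
    (λ s → ℚ.p≤p⊔q (seq (tail v i) k) (seq s k))
    (λ z {s} h → ℚ.≤-trans h (ℚ.p≤q⊔p (seq z k) (seq s k)))

-- The objective as a function of its aggregates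

minus-cong : ∀ {x x′ y y′} → x ≈ x′ → y ≈ y′ → x - y ≈ x′ - y′
minus-cong {x} {x′} {y} {y′} h k =
  +-cong {x} {x′} { - y} { - y′} h (-‿cong {y} {y′} k)

penalty-cong : ∀ {r r′ Q Q′ A A′} → r ≈ r′ → Q ≈ Q′ → A ≈ A′ →
  r * r - Q + A ≈ r′ * r′ - Q′ + A′
penalty-cong {r} {r′} {Q} {Q′} {A} {A′} r≈ Q≈ A≈ =
  +-cong {r * r - Q} {r′ * r′ - Q′} {A} {A′}
    (minus-cong {r * r} {r′ * r′} {Q} {Q′} (*-cong {r} {r′} {r} {r′} r≈ r≈) Q≈) A≈

-- Here `S` is the slack, `B` the capacity, and `W`, `A`, `Q` stand for `w · x`, `a · x` and the
-- `a`-weighted sum of squares. Only the last three change when a core variable moves.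
objective : ℝ → ℝ → ℝ → ℝ → ℝ → ℝ → ℝ
objective γ S B W A Q = - W + γ * ((A + S - B) * (A + S - B) - Q + A)

objective-def : ∀ γ S B W A Q →
  - W + γ * ((A + S - B) * (A + S - B) - Q + A) ≡ objective γ S B W A Q
objective-def γ S B W A Q = refl

-- The definitions of the objective, the penalty and the residual enter as three separate equations,
-- so each layer is unfolded on its own.
expand-objective : ∀ {γ S B W A Q r v F} → F ≈ - W + γ * v →
  v ≈ r * r - Q + A → r ≈ A + S - B → F ≈ objective γ S B W A Q
expand-objective {γ} {S} {B} {W} {A} {Q} {r} {v} {F} F≈ v≈ r≈ = subst (F ≈_)
  (objective-def γ S B W A Q)
  (≈-trans {F} { - W + γ * v} { - W + γ * ((A + S - B) * (A + S - B) - Q + A)} F≈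
    (+-cong { - W} { - W} {γ * v} {γ * ((A + S - B) * (A + S - B) - Q + A)}
      (≈-refl { - W})
      (*-cong {γ} {γ} {v} {(A + S - B) * (A + S - B) - Q + A} (≈-refl {γ})
        (≈-trans {v} {r * r - Q + A} {(A + S - B) * (A + S - B) - Q + A} v≈
          (penalty-cong {r} {A + S - B} {Q} {Q} {A} {A} r≈ (≈-refl {Q}) (≈-refl {A}))))))

module _ {n M} (w a : Vector ℝ n) (b : ℕ) (γ : ℝ)
  (x : Vector ℝ n) (y : Vector ℝ (suc M)) where

  private
    f̂-seq : ∀ k → seq (f̂ w a b γ x y) k ≡ seq (- (w · x) + γ * V-be a b x y) k
    f̂-seq k = refl

    V-seq : ∀ k → seq (V-be a b x y) k ≡
      seq (residual a b x y * residual a b x y - a · map (λ t → t * t) x + a · x) k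
    V-seq k = refl

    residual-seq : ∀ k → seq (residual a b x y) k ≡ seq (a · x + slack y - fromℕ b) k
    residual-seq k = refl

  f̂≈objective : f̂ w a b γ x y ≈
    objective γ (slack y) (fromℕ b) (w · x) (a · x) (a · map (λ t → t * t) x)
  f̂≈objective = expand-objective {γ} {slack y} {fromℕ b} {w · x} {a · x}
    {a · map (λ t → t * t) x} {residual a b x y} {V-be a b x y} {f̂ w a b γ x y}
    (≗⇒≈ {f̂ w a b γ x y} { - (w · x) + γ * V-be a b x y} f̂-seq)
    (≗⇒≈ {V-be a b x y}
      {residual a b x y * residual a b x y - a · map (λ t → t * t) x + a · x} V-seq)
    (≗⇒≈ {residual a b x y} {a · x + slack y - fromℕ b} residual-seq)

objective-cong : ∀ γ S B {W W′ A A′ Q Q′} → W ≈ W′ → A ≈ A′ → Q ≈ Q′ →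
  objective γ S B W A Q ≈ objective γ S B W′ A′ Q′
objective-cong γ S B {W} {W′} {A} {A′} {Q} {Q′} W≈ A≈ Q≈ = subst₂ _≈_
  (objective-def γ S B W A Q) (objective-def γ S B W′ A′ Q′)
  (+-cong { - W} { - W′}
    {γ * ((A + S - B) * (A + S - B) - Q + A)}
    {γ * ((A′ + S - B) * (A′ + S - B) - Q′ + A′)}
    (-‿cong {W} {W′} W≈)
    (*-cong {γ} {γ} {(A + S - B) * (A + S - B) - Q + A}
      {(A′ + S - B) * (A′ + S - B) - Q′ + A′} (≈-refl {γ})
      (penalty-cong {A + S - B} {A′ + S - B} {Q} {Q′} {A} {A′}
        (minus-cong {A + S} {A′ + S} {B} {B}
          (+-cong {A} {A′} {S} {S} A≈ (≈-refl {S})) (≈-refl {B}))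
        Q≈ A≈)))

-- Strict decrease along one coordinate

objective-descent : ∀ γ ω q W A Q S B →
  objective γ S B W A Q ≈
  objective γ S B (W + ω * (1ℝ - q - 1ℝ)) (A + 1ℝ * (1ℝ - q - 1ℝ))
    (Q + 1ℝ * ((1ℝ - q) * (1ℝ - q) - 1ℝ * 1ℝ))
  + q * (γ - ω + γ * (A + S - B - 1ℝ + (A + S - B - 1ℝ)))
objective-descent γ ω q W A Q S B = subst₂
  (λ s t → s ≈ t + q * (γ - ω + γ * (A + S - B - 1ℝ + (A + S - B - 1ℝ))))
  (objective-def γ S B W A Q)
  (objective-def γ S B (W + ω * (1ℝ - q - 1ℝ)) (A + 1ℝ * (1ℝ - q - 1ℝ))
    (Q + 1ℝ * ((1ℝ - q) * (1ℝ - q) - 1ℝ * 1ℝ)))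
  (descent γ ω q W A Q S B)

-- Strictness comes from `γ - ω` alone; the remaining term need only be nonnegative, which is what
-- `1ℝ ≤ r` provides.
gain-pos : ∀ {γ ω q r} → 0ℝ < γ → ω < γ → 0ℝ < q → 1ℝ ≤ r →
  0ℝ < q * (γ - ω + γ * (r - 1ℝ + (r - 1ℝ)))
gain-pos {γ} {ω} {q} {r} 0<γ ω<γ 0<q 1≤r =
  *-pos {q} {γ - ω + γ * (r - 1ℝ + (r - 1ℝ))} 0<q
    (<-≤-trans {0ℝ} {γ - ω} {γ - ω + γ * (r - 1ℝ + (r - 1ℝ))}
      (x<y⇒0<y-x {ω} {γ} ω<γ)
      (x≤x+y {γ - ω} {γ * (r - 1ℝ + (r - 1ℝ))}
        (pos*nonneg {γ} {r - 1ℝ + (r - 1ℝ)} 0<γ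
          (≤-trans {0ℝ} {r - 1ℝ} {r - 1ℝ + (r - 1ℝ)} 0≤r-1
            (x≤x+y {r - 1ℝ} {r - 1ℝ} 0≤r-1)))))
  where
  0≤r-1 : 0ℝ ≤ r - 1ℝ
  0≤r-1 = x≤y⇒0≤y-x {1ℝ} {r} 1≤r

shift-cong : ∀ {z W u u′ d d′} → z ≈ W + u * d → u ≈ u′ → d ≈ d′ → z ≈ W + u′ * d′
shift-cong {z} {W} {u} {u′} {d} {d′} z≈ u≈ d≈ =
  ≈-trans {z} {W + u * d} {W + u′ * d′} z≈
    (+-cong {W} {W} {u * d} {u′ * d′} (≈-refl {W}) (*-cong {u} {u′} {d} {d′} u≈ d≈))

objective-decreases : ∀ {γ ω q S B W A Q W′ A′ Q′ F F′} →
  0ℝ < γ → ω < γ → 0ℝ < q → 1ℝ ≤ A + S - B →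
  W′ ≈ W + ω * (1ℝ - q - 1ℝ) →
  A′ ≈ A + 1ℝ * (1ℝ - q - 1ℝ) →
  Q′ ≈ Q + 1ℝ * ((1ℝ - q) * (1ℝ - q) - 1ℝ * 1ℝ) →
  F ≈ objective γ S B W A Q → F′ ≈ objective γ S B W′ A′ Q′ → F′ < F
objective-decreases {γ} {ω} {q} {S} {B} {W} {A} {Q} {W′} {A′} {Q′} {F} {F′}
  0<γ ω<γ 0<q 1≤r W≈ A≈ Q≈ F≈ F′≈ =
  squeeze {objective γ S B W A Q}
    {objective γ S B (W + ω * (1ℝ - q - 1ℝ)) (A + 1ℝ * (1ℝ - q - 1ℝ))
      (Q + 1ℝ * ((1ℝ - q) * (1ℝ - q) - 1ℝ * 1ℝ))}
    {objective γ S B W′ A′ Q′}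
    {q * (γ - ω + γ * (A + S - B - 1ℝ + (A + S - B - 1ℝ)))}
    F≈ (objective-descent γ ω q W A Q S B) F′≈
    (objective-cong γ S B
      {W′} {W + ω * (1ℝ - q - 1ℝ)} {A′} {A + 1ℝ * (1ℝ - q - 1ℝ)}
      {Q′} {Q + 1ℝ * ((1ℝ - q) * (1ℝ - q) - 1ℝ * 1ℝ)} W≈ A≈ Q≈)
    (gain-pos {γ} {ω} {q} {A + S - B} 0<γ ω<γ 0<q 1≤r)
  where
  squeeze : ∀ {O O₁ O′ g} → F ≈ O → O ≈ O₁ + g → F′ ≈ O′ → O′ ≈ O₁ → 0ℝ < g → F′ < F
  -- The chain is `F′ ≈ O′ ≈ O₁ < O₁ + g ≈ O ≈ F`.
  squeeze {O} {O₁} {O′} {g} F≈ O≈ F′≈ O′≈ 0<g =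
    ≤-<-trans {F′} {O₁} {F} (≈⇒≤ {F′} {O₁} (≈-trans {F′} {O′} {O₁} F′≈ O′≈))
      (<-≤-trans {O₁} {O₁ + g} {F} (x<x+y {O₁} {g} 0<g)
        (≈⇒≤ {O₁ + g} {F} (≈-sym {F} {O₁ + g} (≈-trans {F} {O} {O₁ + g} F≈ O≈))))

f̂-decreases : ∀ {n M} (w a : Vector ℝ n) b γ x (y : Vector ℝ (suc M)) i q →
  a i ≈ 1ℝ → x i ≈ 1ℝ → 0ℝ < γ → w i < γ → 0ℝ < q →
  1ℝ ≤ a · x + slack y - fromℕ b →
  f̂ w a b γ (updateAt x i (λ _ → 1ℝ - q)) y < f̂ w a b γ x y
f̂-decreases w a b γ x y i q a≈1 x≈1 0<γ w<γ 0<q 1≤r = objective-decreases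
  {γ} {w i} {q} {slack y} {fromℕ b} {w · x} {a · x} {a · map (λ t → t * t) x}
  {w · updateAt x i (λ _ → 1ℝ - q)} {a · updateAt x i (λ _ → 1ℝ - q)}
  {a · map (λ t → t * t) (updateAt x i (λ _ → 1ℝ - q))}
  {f̂ w a b γ x y} {f̂ w a b γ (updateAt x i (λ _ → 1ℝ - q)) y}
  0<γ w<γ 0<q 1≤r
  -- The three aggregates shift by the change in entry `i`; `a i` and `x i` are then replaced by 1
  -- to match `descent`, while `w i` stays.
  (shift-cong {w · updateAt x i (λ _ → 1ℝ - q)} {w · x} {w i} {w i}
    {1ℝ - q - x i} {1ℝ - q - 1ℝ}
    (dot-updateAt w x i (λ _ → 1ℝ - q)) (≈-refl {w i}) linear)
  (shift-cong {a · updateAt x i (λ _ → 1ℝ - q)} {a · x} {a i} {1ℝ}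
    {1ℝ - q - x i} {1ℝ - q - 1ℝ}
    (dot-updateAt a x i (λ _ → 1ℝ - q)) a≈1 linear)
  (shift-cong {a · map (λ t → t * t) (updateAt x i (λ _ → 1ℝ - q))}
    {a · map (λ t → t * t) x} {a i} {1ℝ}
    {(1ℝ - q) * (1ℝ - q) - x i * x i} {(1ℝ - q) * (1ℝ - q) - 1ℝ * 1ℝ}
    (dot-map-updateAt a x i (λ _ → 1ℝ - q) (λ t → t * t)) a≈1 quadratic)
  (f̂≈objective w a b γ x y)
  (f̂≈objective w a b γ (updateAt x i (λ _ → 1ℝ - q)) y)
  where
  linear : 1ℝ - q - x i ≈ 1ℝ - q - 1ℝ
  linear = minus-cong {1ℝ - q} {1ℝ - q} {x i} {1ℝ} (≈-refl {1ℝ - q}) x≈1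

  quadratic : (1ℝ - q) * (1ℝ - q) - x i * x i ≈ (1ℝ - q) * (1ℝ - q) - 1ℝ * 1ℝ
  quadratic = minus-cong {(1ℝ - q) * (1ℝ - q)} {(1ℝ - q) * (1ℝ - q)}
    {x i * x i} {1ℝ * 1ℝ} (≈-refl {(1ℝ - q) * (1ℝ - q)})
    (*-cong {x i} {1ℝ} {x i} {1ℝ} x≈1 x≈1)

-- The lowered point as a nearby competitor in the box

∣-∣-< : ∀ {z ε} → z < ε → - z < ε → ∣ z ∣ < ε
∣-∣-< {z} {ε} = ⊔-lub-< {z} { - z} {ε}

-- Needed for the coordinates that do not move, including all slack bits.
∣x-x∣< : ∀ {x ε} → 0ℝ < ε → ∣ x - x ∣ < ε
∣x-x∣< {x} {ε} 0<ε = ∣-∣-< {x - x} {ε} x-x<ε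
  (≤-<-trans { - (x - x)} {x - x} {ε}
    (≈⇒≤ { - (x - x)} {x - x} (≈-sym {x - x} { - (x - x)} (x-x≈-[x-x] x))) x-x<ε)
  where
  x-x<ε : x - x < ε
  x-x<ε = ≤-<-trans {x - x} {0ℝ} {ε}
    (pointwise-≤ {x - x} {0ℝ} λ n → ℚ.≤-reflexive (ℚ.+-inverseʳ (seq x n))) 0<ε

∣1-q-x∣< : ∀ {x q ε} → x ≈ 1ℝ → 0ℝ < q → q < ε → ∣ 1ℝ - q - x ∣ < ε
∣1-q-x∣< {x} {q} {ε} x≈1 0<q q<ε = ∣-∣-< {1ℝ - q - x} {ε}
  (≤-<-trans {1ℝ - q - x} { - q} {ε} (≈⇒≤ {1ℝ - q - x} { - q} ≈-q)
    (<-≤-trans { - q} {0ℝ} {ε} (0<x⇒-x<0 {q} 0<q)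
      (≤-trans {0ℝ} {q} {ε} (<⇒≤ {0ℝ} {q} 0<q) (<⇒≤ {q} {ε} q<ε))))
  (≤-<-trans { - (1ℝ - q - x)} {q} {ε}
    (≈⇒≤ { - (1ℝ - q - x)} {q}
      (≈-trans { - (1ℝ - q - x)} { - (- q)} {q}
        (-‿cong {1ℝ - q - x} { - q} ≈-q) (neg-involutive q))) q<ε)
  where
  ≈-q : 1ℝ - q - x ≈ - q
  ≈-q = ≈-trans {1ℝ - q - x} {1ℝ - q - 1ℝ} { - q}
    (minus-cong {1ℝ - q} {1ℝ - q} {x} {1ℝ} (≈-refl {1ℝ - q}) x≈1) ([1-q]-1≈-q q)

1-fromℚ∈[0,1] : ∀ {p} → 0ℚ ℚ.< p → p ℚ.≤ 1ℚ →
  0ℝ ≤ 1ℝ - fromℚ p × 1ℝ - fromℚ p ≤ 1ℝ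
1-fromℚ∈[0,1] {p} 0<p p≤1 =
    pointwise-≤ {0ℝ} {1ℝ - fromℚ p} (λ _ →
      subst (ℚ._≤ 1ℚ ℚ.- p) (ℚ.+-inverseʳ p) (ℚ.+-monoˡ-≤ (ℚ.- p) p≤1))
  , pointwise-≤ {1ℝ - fromℚ p} {1ℝ} (λ _ →
      subst (1ℚ ℚ.- p ℚ.≤_) (ℚ.+-identityʳ 1ℚ)
        (ℚ.+-monoʳ-≤ 1ℚ (ℚ.neg-antimono-≤ (ℚ.<⇒≤ 0<p))))

not-minimizer : ∀ {n M} (w a : Vector ℝ n) b γ x (y : Vector ℝ (suc M)) i →
  a i ≈ 1ℝ → x i ≈ 1ℝ → 0ℝ < γ → w i < γ → 1ℝ ≤ a · x + slack y - fromℕ b →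
  ¬ IsLocalMinimizer (f̂ w a b γ) x y
not-minimizer w a b γ x y i a≈1 x≈1 0<γ w<γ 1≤r (x∈ , y∈ , ε , 0<ε , minimal) =
  -- The bound `p ≤ 1` keeps the lowered coordinate in the unit interval, and `p < ε` keeps the
  -- point in the neighbourhood where `x , y` is minimal.
  let p , 0<p , p≤1 , p<ε = small-positive {ε} 0<ε
      0<q                 = fromℚ-pos 0<p
  in <-irrefl {f̂ w a b γ x y}
    (≤-<-trans {f̂ w a b γ x y}
      {f̂ w a b γ (updateAt x i (λ _ → 1ℝ - fromℚ p)) y} {f̂ w a b γ x y}
      (minimal (updateAt x i (λ _ → 1ℝ - fromℚ p)) y
        (updateAt-elim (λ _ z → 0ℝ ≤ z × z ≤ 1ℝ) x i (λ _ → 1ℝ - fromℚ p)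
          (1-fromℚ∈[0,1] 0<p p≤1) x∈)
        y∈
        (updateAt-elim (λ j z → ∣ z - x j ∣ < ε) x i (λ _ → 1ℝ - fromℚ p)
          (∣1-q-x∣< {x i} {fromℚ p} {ε} x≈1 0<q p<ε)
          (λ j → ∣x-x∣< {x j} {ε} 0<ε))
        (λ j → ∣x-x∣< {y j} {ε} 0<ε))
      (f̂-decreases w a b γ x y i (fromℚ p) a≈1 x≈1 0<γ w<γ 0<q 1≤r))

-- Infeasibility forces a large residual; conclusion

x+y≤z⇒x≤z-y : ∀ {x y z} → x + y ≤ z → x ≤ z - y
x+y≤z⇒x≤z-y {x} {y} {z} h ε 0<ε = eventually-map
  (λ n p → subst₂ ℚ._<_
    (solve 2 (λ a b → (a :+ b) :- b := a) refl (seq x n) (seq y n))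
    (solve 3 (λ b c e → (c :+ e) :- b := (c :- b) :+ e) refl (seq y n) (seq z n) ε)
    (ℚ.+-monoˡ-< (ℚ.- seq y n) p))
  (h ε 0<ε)

slack-nonneg : ∀ {M} (y : Vector ℝ (suc M)) → InBox y → 0ℝ ≤ slack y
slack-nonneg y y∈ = dot-nonneg (λ ℓ → fromℕ (2 ℕ.^ toℕ ℓ)) y
  (λ ℓ → fromℕ-pos (2 ℕ.^ toℕ ℓ) {{ℕ.m^n≢0 2 (toℕ ℓ)}}) (λ ℓ → proj₁ (y∈ ℓ))

-- Integrality gives `k ≥ b + 1`, and a nonnegative slack can only increase the residual.
residual≥1 : ∀ {A S} b k → A ≈ fromℕ k → b ℕ.< k → 0ℝ ≤ S → 1ℝ ≤ A + S - fromℕ b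
residual≥1 {A} {S} b k A≈k b<k 0≤S = x+y≤z⇒x≤z-y {1ℝ} {fromℕ b} {A + S}
  (≤-trans {1ℝ + fromℕ b} {fromℕ (suc b)} {A + S}
    (≈⇒≤ {1ℝ + fromℕ b} {fromℕ (suc b)}
      (≈-sym {fromℕ (suc b)} {1ℝ + fromℕ b} (fromℕ-suc b)))
    (≤-trans {fromℕ (suc b)} {fromℕ k} {A + S} (fromℕ-mono-≤ b<k)
      (≤-trans {fromℕ k} {A} {A + S}
        (≈⇒≤ {fromℕ k} {A} (≈-sym {A} {fromℕ k} A≈k)) (x≤x+y {A} {S} 0≤S))))

theorem3p6 : (n : ℕ) .{{_ : NonZero n}} (w a : Vector ℝ n) → Binary a →
    (b M : ℕ) (γ : ℝ) → 0ℝ < γ →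
    (∀ (x : Vector ℝ n) (y : Vector ℝ (suc M)) →
    IsLocalMinimizer (f̂ w a b γ) x y → Binary x) →
    maximum w < γ →
    ∀ (x : Vector ℝ n) (y : Vector ℝ (suc M)) →
    IsLocalMinimizer (f̂ w a b γ) x y → Feasible a b x
theorem3p6 n w a a∈ b M γ 0<γ binary-core max<γ x y minimizer =
  -- Order on these reals is not decidable, but a binary core makes `a · x` a natural number `k`,
  -- and comparing `k` with `b` is decidable.
  let k , a·x≈k , support = dot-binary a x a∈ (binary-core x y minimizer)
  in binary-core x y minimizer , bound k a·x≈k support (ℕ.≤-<-connex k b)
  where
  bound : ∀ k → a · x ≈ fromℕ k → k ≡ 0 ⊎ (∃[ i ] (a i ≈ 1ℝ × x i ≈ 1ℝ)) →
    k ℕ.≤ b ⊎ b ℕ.< k → a · x ≤ fromℕ b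
  bound k a·x≈k _ (inj₁ k≤b) = ≤-trans {a · x} {fromℕ k} {fromℕ b}
    (≈⇒≤ {a · x} {fromℕ k} a·x≈k) (fromℕ-mono-≤ k≤b)
  -- A zero count cannot exceed `b`, so in the infeasible case there is an index to lower.
  bound _ _ (inj₁ refl) (inj₂ ())
  bound k a·x≈k (inj₂ (i , a≈1 , x≈1)) (inj₂ b<k) = ⊥-elim
    (not-minimizer w a b γ x y i a≈1 x≈1 0<γ
      (≤-<-trans {w i} {maximum w} {γ} (lookup≤maximum w i) max<γ)
      (residual≥1 {a · x} {slack y} b k a·x≈k b<k
        (slack-nonneg y (proj₁ (proj₂ minimizer))))
      minimizer)
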